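{- For every graph $H$ (with at least one vertex) and every positive integer $t$, the limit $\displaystyle\lim_{N\to\infty}\frac{\operatorname{cov}_{K_t}(N,H)}{N}$ exists.
   Context: All graphs are finite and simple. A graph $G$ is $H$-covered if every vertex of $G$ lies in a (not necessarily induced) subgraph of $G$ isomorphic to $H$. For $N\ge |V(H)|$, $\operatorname{cov}_{K_t}(N,H)$ denotes the minimum number of subgraphs isomorphic to $K_t$ among all $H$-covered graphs with $N$ vertices. -}

module Defs where

open import Data.Bool.Base using (true)
open import Data.Fin.Base using (Fin; zero; inject≤; combine; remQuot; finToFun; funToFin)
open import Data.Fin.Permutation using (Permutation′; transpose; _⟨$⟩ʳ_)
open import Data.Fin.Properties
  using (_≟_; any?; all?; remQuot-combine; inject≤-injective; finToFun-funToFin)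
open import Data.Fin.Subset using (Subset; inside; outside; _∈_; ∣_∣)
open import Data.Fin.Subset.Properties using (_∈?_; anySubset?)
open import Data.Integer.Base using (+_)
open import Data.List.Base using (List; [_]; _++_; map; filter; length)
open import Data.List.Properties using (filter-≐)
open import Data.Nat.Base as ℕ using (ℕ; zero; suc; _*_; _≤_; z≤n; s≤s; NonZero)
import Data.Nat.Properties as ℕ
open import Data.Product.Base using (∃; _×_; _,_; proj₁; proj₂)
open import Data.Rational.Base as ℚ using (ℚ; 0ℚ)
open import Data.Sum.Base using (_⊎_; inj₁; inj₂; [_,_]′; swap)
open import Data.Vec.Base as Vec using (tabulate)
open import Data.Vec.Properties using (lookup∘tabulate; lookup⇒[]=; []=⇒lookup)
open import Function.Base using (_∘_)
open import Function.Bundles using (Inverse; _⇔_; Equivalence; mk⇔)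
open import Function.Definitions using (Injective)
open import Level using (0ℓ)
open import Relation.Binary.Core using (Rel)
open import Relation.Binary.Definitions using (Decidable; Symmetric; Irreflexive)
open import Relation.Binary.PropositionalEquality
  using (_≡_; _≢_; refl; sym; trans; cong; subst)
open import Relation.Nullary
  using (¬_; Dec; yes; no; does; contradiction; ¬?; _×-dec_; _⊎-dec_; _→-dec_)
open import Relation.Nullary.Decidable using (map′; dec-true)

record Graph (n : ℕ) : Set₁ where
  field
    Adj         : Rel (Fin n) 0ℓ
    Adj?        : Decidable Adj
    symmetric   : Symmetric Adj
    irreflexive : Irreflexive _≡_ Adj

open Graph public

-- The image of an injective edge-preserving map is a (not necessarily
-- induced) subgraph of G isomorphic to H, and every such subgraph arises
-- in this way.
record Copy {h n : ℕ} (H : Graph h) (G : Graph n) : Set where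
  field
    vertex    : Fin h → Fin n
    injective : Injective _≡_ _≡_ vertex
    edge      : ∀ {i j} → Adj H i j → Adj G (vertex i) (vertex j)

open Copy public

Covered : ∀ {h n} → Graph h → Graph n → Set
Covered {n = n} H G = (v : Fin n) → ∃ λ (c : Copy H G) → ∃ λ i → vertex c i ≡ v

IsClique : ∀ {n} → Graph n → ℕ → Subset n → Set
IsClique G t S = ∣ S ∣ ≡ t × (∀ i j → i ∈ S → j ∈ S → i ≢ j → Adj G i j)

isClique? : ∀ {n} (G : Graph n) t (S : Subset n) → Dec (IsClique G t S)
isClique? G t S = (∣ S ∣ ℕ.≟ t) ×-dec
  all? λ i → all? λ j →
    (i ∈? S) →-dec ((j ∈? S) →-dec (¬? (i ≟ j) →-dec Adj? G i j))

-- Every subset occurs exactly once.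
subsets : ∀ n → List (Subset n)
subsets zero    = [ Vec.[] ]
subsets (suc n) = map (inside Vec.∷_) (subsets n) ++ map (outside Vec.∷_) (subsets n)

-- A subgraph isomorphic to K_t contains every edge between its vertices, so
-- it is determined by its vertex set: these subgraphs are counted by t-cliques.
#K : ∀ {n} → ℕ → Graph n → ℕ
#K {n} t G = length (filter (isClique? G t) (subsets n))

record IsCov {h : ℕ} (t N : ℕ) (H : Graph h) (c : ℕ) : Set₁ where
  field
    attained : ∃ λ (G : Graph N) → Covered H G × #K t G ≡ c
    minimal  : (G : Graph N) → Covered H G → c ≤ #K t G

-- Existence of the minimum.  Graphs and maps are encoded by subsets and
-- numbers so that being attained is decidable.
private
  _≈_ : ∀ {n} → Graph n → Graph n → Set
  G ≈ G′ = ∀ i j → Adj G i j ⇔ Adj G′ i j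

  #K-cong : ∀ {n} t (G G′ : Graph n) → G ≈ G′ → #K t G ≡ #K t G′
  #K-cong {n} t G G′ e = cong length
    (filter-≐ (isClique? G t) (isClique? G′ t)
      ( (λ (s , f) → s , λ i j p q r → Equivalence.to   (e i j) (f i j p q r))
      , (λ (s , f) → s , λ i j p q r → Equivalence.from (e i j) (f i j p q r)))
      (subsets n))

  Covered-cong : ∀ {h n} (H : Graph h) (G G′ : Graph n) → G ≈ G′ → Covered H G → Covered H G′
  Covered-cong H G G′ e cov v = let c , i , p = cov v in
    record { vertex = vertex c ; injective = injective c
           ; edge = λ a → Equivalence.to (e _ _) (edge c a) } , i , p

  decode : ∀ {n} → Subset (n * n) → Graph n
  decode S = record
    { Adj         = λ i j → i ≢ j × (combine i j ∈ S ⊎ combine j i ∈ S)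
    ; Adj?        = λ i j → ¬? (i ≟ j) ×-dec ((combine i j ∈? S) ⊎-dec (combine j i ∈? S))
    ; symmetric   = λ (p , q) → p ∘ sym , swap q
    ; irreflexive = λ p (q , _) → q p
    }

  encode : ∀ {n} → Graph n → Subset (n * n)
  encode {n} G = tabulate λ k → let i , j = remQuot n k in does (Adj? G i j)

  encode-lookup : ∀ {n} (G : Graph n) i j → Vec.lookup (encode G) (combine i j) ≡ does (Adj? G i j)
  encode-lookup {n} G i j = trans (lookup∘tabulate _ (combine i j))
    (cong (λ (i , j) → does (Adj? G i j)) (remQuot-combine {n} i j))

  does⇒ : ∀ {A : Set} (d : Dec A) → does d ≡ true → A
  does⇒ (yes a) _ = a

  ∈-encode : ∀ {n} (G : Graph n) i j → combine i j ∈ encode G ⇔ Adj G i j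
  ∈-encode G i j = mk⇔
    (λ m → does⇒ (Adj? G i j) (trans (sym (encode-lookup G i j)) ([]=⇒lookup m)))
    (λ a → lookup⇒[]= _ _ (trans (encode-lookup G i j) (dec-true (Adj? G i j) a)))

  encode-≈ : ∀ {n} (G : Graph n) → G ≈ decode (encode G)
  encode-≈ G i j = mk⇔
    (λ a → (λ p → irreflexive G p a) , inj₁ (Equivalence.from (∈-encode G i j) a))
    (λ (_ , m) → [ Equivalence.to (∈-encode G i j)
                 , symmetric G ∘ Equivalence.to (∈-encode G j i) ]′ m)

  covered? : ∀ {h n} (H : Graph h) (G : Graph n) → Dec (Covered H G)
  covered? {h} {n} H G = all? λ v → map′ (to v) (from v) (any? λ k → good? v (finToFun k))
    where
    Good : Fin n → (Fin h → Fin n) → Set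
    Good v f = (∀ i j → f i ≡ f j → i ≡ j)
             × (∀ i j → Adj H i j → Adj G (f i) (f j))
             × ∃ λ i → f i ≡ v

    good? : ∀ v f → Dec (Good v f)
    good? v f = (all? λ i → all? λ j → (f i ≟ f j) →-dec (i ≟ j))
      ×-dec ((all? λ i → all? λ j → Adj? H i j →-dec Adj? G (f i) (f j))
      ×-dec any? λ i → f i ≟ v)

    to : ∀ v → (∃ λ k → Good v (finToFun k)) → ∃ λ (c : Copy H G) → ∃ λ i → vertex c i ≡ v
    to v (k , inj , adj , i , p) =
      record { vertex = finToFun k ; injective = inj _ _ ; edge = adj _ _ } , i , p

    from : ∀ v → (∃ λ (c : Copy H G) → ∃ λ i → vertex c i ≡ v) → ∃ λ k → Good v (finToFun k)
    from v (c , i , p) = funToFin (vertex c)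
      , (λ i j q → injective c (trans (sym (eq i)) (trans q (eq j))))
      , (λ i j a → subst (Adj G _) (sym (eq j))
                     (subst (λ x → Adj G x _) (sym (eq i)) (edge c a)))
      , i , trans (eq i) p
      where eq = finToFun-funToFin (vertex c)

  complete : ∀ n → Graph n
  complete n = record
    { Adj = _≢_ ; Adj? = λ i j → ¬? (i ≟ j) ; symmetric = _∘ sym ; irreflexive = λ p q → q p }

  transpose-hits : ∀ {n} (i j : Fin n) → transpose i j ⟨$⟩ʳ i ≡ j
  transpose-hits i j with i ≟ i
  ... | yes _   = refl
  ... | no i≢i = contradiction refl i≢i

  complete-covered : ∀ {h N} .{{_ : NonZero h}} (H : Graph h) → h ≤ N → Covered H (complete N)
  complete-covered {suc h} {N} H h≤N v = record
    { vertex    = f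
    ; injective = f-inj
    ; edge      = λ a p → irreflexive H (f-inj p) a
    } , zero , transpose-hits (inject≤ zero h≤N) v
    where
    π : Permutation′ N
    π = transpose (inject≤ zero h≤N) v
    f : Fin (suc h) → Fin N
    f i = π ⟨$⟩ʳ inject≤ i h≤N
    f-inj : Injective _≡_ _≡_ f
    f-inj p = inject≤-injective h≤N h≤N _ _
      (trans (sym (Inverse.strictlyInverseʳ π _))
        (trans (cong (Inverse.from π) p) (Inverse.strictlyInverseʳ π _)))

  least : ∀ {ℓ} {P : ℕ → Set ℓ} → (∀ c → Dec (P c)) → ∀ m → P m →
          ∃ λ c → P c × (∀ d → P d → c ≤ d)
  least P? m p with P? 0
  least P? m       p | yes p₀ = 0 , p₀ , λ _ _ → z≤n
  least P? zero    p | no ¬p₀ = contradiction p ¬p₀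
  least {P = P} P? (suc m) p | no ¬p₀ with least (P? ∘ suc) m p
  ... | c , q , min = suc c , q , λ where
    zero    r → contradiction r ¬p₀
    (suc d) r → s≤s (min d r)

minimum : ∀ {h} .{{_ : NonZero h}} (t N : ℕ) (H : Graph h) → h ≤ N → ∃ (IsCov t N H)
minimum t N H h≤N =
  let c , a , min = least attained? (#K t (complete N))
                      (complete N , complete-covered H h≤N , refl)
  in c , record { attained = a ; minimal = λ G cov → min _ (G , cov , refl) }
  where
  attained? : ∀ c → Dec (∃ λ (G : Graph N) → Covered H G × #K t G ≡ c)
  attained? c = map′ (λ (S , p) → decode {N} S , p)
    (λ (G , cov , p) → encode G
      , Covered-cong H G _ (encode-≈ G) cov
      , trans (sym (#K-cong t G (decode (encode G)) (encode-≈ G))) p)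
    (anySubset? λ S → covered? H (decode {N} S) ×-dec (#K t (decode {N} S) ℕ.≟ c))

cov : ∀ {h} .{{_ : NonZero h}} (t N : ℕ) (H : Graph h) → h ≤ N → ℕ
cov t N H h≤N = proj₁ (minimum t N H h≤N)

cov-isCov : ∀ {h} .{{_ : NonZero h}} (t N : ℕ) (H : Graph h) (h≤N : h ≤ N) →
            IsCov t N H (cov t N H h≤N)
cov-isCov t N H h≤N = proj₂ (minimum t N H h≤N)

covRatio : ∀ {h} .{{_ : NonZero h}} (t : ℕ) (H : Graph h) (N : ℕ) → h ≤ N → ℚ
covRatio {h} t H N h≤N = ℚ._/_ (+ cov t N H h≤N) N {{N≢0}}
  where
  .N≢0 : NonZero N
  N≢0 = ℕ.>-nonZero (ℕ.≤-trans (ℕ.>-nonZero⁻¹ h) h≤N)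

-- Two-sided Dedekind cuts: Lower q means q < x and Upper q means x < q.
record ℝ : Set₁ where
  field
    Lower Upper     : ℚ → Set
    lower-inhabited : ∃ Lower
    upper-inhabited : ∃ Upper
    lower-rounded   : ∀ p → Lower p ⇔ (∃ λ q → p ℚ.< q × Lower q)
    upper-rounded   : ∀ q → Upper q ⇔ (∃ λ p → p ℚ.< q × Upper p)
    disjoint        : ∀ q → ¬ (Lower q × Upper q)
    located         : ∀ p q → p ℚ.< q → Lower p ⊎ Upper q

open ℝ public

-- ∣ q - x ∣ < ε, in the form q - ε < x < q + ε.
∣_-_∣<_ : ℚ → ℝ → ℚ → Set
∣ q - x ∣< ε = Lower x (q ℚ.- ε) × Upper x (q ℚ.+ ε)

-- Limit as N → ∞ of a sequence whose terms are defined for N ≥ k only.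
HasLimit : {k : ℕ} → (∀ N → k ≤ N → ℚ) → ℝ → Set
HasLimit {k} a L = ∀ ε → 0ℚ ℚ.< ε →
  ∃ λ M → ∀ N (k≤N : k ≤ N) → M ≤ N → ∣ a N k≤N - L ∣< ε

{-# OPTIONS --safe #-}
module Submission where

-- For S ⊆ V(H) let w(S) be the number of t-cliques of H that meet S.  The limit
-- is the minimum L of w(S) / |S| over nonempty S, and cov(N) = L N + O(1).
-- Lower bound: exhaust a covered graph by copies of H, each through a vertex not
-- yet reached; a copy whose new vertices correspond to S brings |S| ≥ 1 vertices
-- and at least w(S) ≥ L |S| new cliques.
-- Upper bound: start from H and repeatedly attach a fresh clone of an optimal S to
-- the rest of H, at a cost of w(S) cliques for |S| vertices; fewer than |S| further
-- clones of a single vertex adjust the total to N.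
-- Having L as an explicit rational number with an O(1) error is what makes the
-- argument constructive: Fekete's lemma yields no modulus of convergence.

open import Defs
open import Data.Bool.Base using (true)
open import Data.Fin.Base using (Fin; zero; suc; _↑ˡ_; _↑ʳ_; splitAt)
open import Data.Fin.Properties
  using (_≟_; any?; injective⇒≤; ↑ˡ-injective; ↑ʳ-injective; splitAt-↑ˡ; splitAt-↑ʳ;
         splitAt⁻¹-↑ˡ; splitAt⁻¹-↑ʳ)
  renaming (suc-injective to Fin-suc-injective)
open import Data.Fin.Subset
  using (Subset; inside; outside; _∈_; _∉_; _⊆_; ∣_∣; _∪_; _∩_; ∁; ⊤; ⊥; ⁅_⁆; Nonempty)
open import Data.Fin.Subset.Properties
  using (_∈?_; _⊆?_; nonempty?; ⊆-antisym; x∈p∩q⁺; x∈p∩q⁻; x∈p∪q⁺; x∈∁p⇒x∉p; x∉p⇒x∈∁p;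
         ∣⊥∣≡0; ∣⊤∣≡n; ∣⁅x⁆∣≡1; p⊆q⇒∣p∣≤∣q∣)
import Data.Integer.Base as ℤ
import Data.Integer.Properties as ℤ
open import Data.List.Base using (List; []; _∷_; _++_; map; filter; length; allFin; lookup)
open import Data.List.Membership.Propositional using () renaming (_∈_ to _∈ˡ_)
open import Data.List.Membership.Propositional.Properties
  using (∈-filter⁺; ∈-filter⁻; ∈-map⁺; ∈-map⁻; ∈-++⁺ˡ; ∈-++⁺ʳ; ∈-++⁻; ∈-lookup; ∈-allFin)
open import Data.List.Membership.Setoid.Properties using (index-injective)
open import Data.List.Properties using (length-map; length-++)
open import Data.List.Relation.Binary.Subset.Propositional using () renaming (_⊆_ to _⊆ˡ_)
open import Data.List.Relation.Unary.All as All using (All; []; _∷_)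
open import Data.List.Relation.Unary.AllPairs using ([]; _∷_)
open import Data.List.Relation.Unary.Any as Any using (here; there)
open import Data.List.Relation.Unary.Unique.Propositional using (Unique)
import Data.List.Relation.Unary.Unique.Propositional.Properties as Unique
open import Data.Nat.Base
open import Data.Nat.DivMod using (_/_; _%_; m≡m%n+[m/n]*n; m%n≤n)
open import Data.Nat.Properties hiding (_≟_)
open import Data.Nat.Tactic.RingSolver using (solve-∀)
open import Data.Product.Base using (∃; _×_; _,_; proj₁; proj₂)
open import Data.Rational.Base as ℚ using (ℚ; mkℚ; 0ℚ)
import Data.Rational.Properties as ℚ
open import Data.Rational.Unnormalised.Base as ℚᵘ using (mkℚᵘ)
import Data.Rational.Unnormalised.Properties as ℚᵘ
open import Data.Sum.Base as Sum using (_⊎_; inj₁; inj₂)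
open import Data.Vec.Base as Vec using (tabulate; []; _∷_)
open import Data.Vec.Properties using (lookup∘tabulate; lookup⇒[]=; []=⇒lookup; ∷-injectiveʳ)
open import Function.Base using (_∘_; id)
open import Function.Bundles using (mk⇔)
open import Function.Definitions using (Injective)
open import Relation.Binary.PropositionalEquality
open import Relation.Nullary
open import Relation.Nullary.Decidable using (dec-true; toSum)
open import Relation.Unary using (Decidable)

private variable
  h k m n t : ℕ
  i j : Fin n

-- Duplicate-free lists and the enumeration of all subsets.

lookup-injective : {A : Set} {xs : List A} → Unique xs → Injective _≡_ _≡_ (lookup xs)
lookup-injective (_ ∷ _)  {zero}  {zero}  _ = refl
lookup-injective {xs = _ ∷ xs} (a ∷ _) {zero}  {suc j} p = contradiction p (All.lookup a (∈-lookup {xs = xs} j))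
lookup-injective {xs = _ ∷ xs} (a ∷ _) {suc i} {zero}  p = contradiction (sym p) (All.lookup a (∈-lookup {xs = xs} i))
lookup-injective (_ ∷ u)  {suc i} {suc j} p = cong suc (lookup-injective u p)

-- Sending a position of `xs` to a position of the same element in `ys` is injective. Cliques are
-- counted by lengths of duplicate-free lists, so every comparison of clique counts below goes
-- through this lemma.
unique-⊆⇒length≤ : {A : Set} {xs ys : List A} → Unique xs → xs ⊆ˡ ys → length xs ≤ length ys
unique-⊆⇒length≤ {A} {xs} u xs⊆ys =
  injective⇒≤ {f = λ i → Any.index (xs⊆ys (∈-lookup {xs = xs} i))}
    (λ eq → lookup-injective u (index-injective (setoid A) (xs⊆ys (∈-lookup _)) (xs⊆ys (∈-lookup _)) eq))

subsets-unique : ∀ n → Unique (subsets n)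
subsets-unique zero    = [] ∷ []
subsets-unique (suc n) = Unique.++⁺
  (Unique.map⁺ ∷-injectiveʳ (subsets-unique n))
  (Unique.map⁺ ∷-injectiveʳ (subsets-unique n))
  disjoint′
  where
  disjoint′ : ∀ {X} → ¬ (X ∈ˡ map (inside ∷_) (subsets n) × X ∈ˡ map (outside ∷_) (subsets n))
  disjoint′ (p , q) with ∈-map⁻ _ p | ∈-map⁻ _ q
  ... | _ , _ , refl | _ , _ , ()

∈-subsets : (X : Subset n) → X ∈ˡ subsets n
∈-subsets []            = here refl
∈-subsets (inside  ∷ X) = ∈-++⁺ˡ (∈-map⁺ _ (∈-subsets X))
∈-subsets {suc n} (outside ∷ X) = ∈-++⁺ʳ (map (inside ∷_) (subsets n)) (∈-map⁺ _ (∈-subsets X))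

-- Elements and cardinality of a subset.

pick : (X : Subset n) → Fin ∣ X ∣ → Fin n
pick (inside  ∷ X) zero    = zero
pick (inside  ∷ X) (suc k) = suc (pick X k)
pick (outside ∷ X) k       = suc (pick X k)

pick-∈ : (X : Subset n) (k : Fin ∣ X ∣) → pick X k ∈ X
pick-∈ (inside  ∷ X) zero    = Vec.here
pick-∈ (inside  ∷ X) (suc k) = Vec.there (pick-∈ X k)
pick-∈ (outside ∷ X) k       = Vec.there (pick-∈ X k)

-- Inverse to `pick`. Together they identify the members of `X` with `Fin ∣ X ∣`, which later
-- indexes the fresh clones of the vertices in a set.
rank : {X : Subset n} → i ∈ X → Fin ∣ X ∣
rank {X = inside  ∷ X} Vec.here      = zero
rank {X = inside  ∷ X} (Vec.there p) = suc (rank p)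
rank {X = outside ∷ X} (Vec.there p) = rank p

pick-rank : {X : Subset n} (p : i ∈ X) → pick X (rank p) ≡ i
pick-rank {X = inside  ∷ X} Vec.here      = refl
pick-rank {X = inside  ∷ X} (Vec.there p) = cong suc (pick-rank p)
pick-rank {X = outside ∷ X} (Vec.there p) = cong suc (pick-rank p)

rank-injective : {X : Subset n} (p : i ∈ X) (q : j ∈ X) → rank p ≡ rank q → i ≡ j
rank-injective {X = X} p q eq = trans (sym (pick-rank p)) (trans (cong (pick X) eq) (pick-rank q))

pick-injective : (X : Subset n) → Injective _≡_ _≡_ (pick X)
pick-injective (inside  ∷ X) {zero}  {zero}  _  = refl
pick-injective (inside  ∷ X) {suc k} {suc l} eq = cong suc (pick-injective X (Fin-suc-injective eq))
pick-injective (outside ∷ X)                 eq = pick-injective X (Fin-suc-injective eq)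

-- `g` receives the membership proof, so that it may return a preimage read off a proof of
-- `j ∈ image X`, as in `∣image∣`.
injection⇒∣∣≤ : {X : Subset m} {Y : Subset n} (g : ∀ {i} → i ∈ X → Fin n) →
                (∀ {i} (p : i ∈ X) → g p ∈ Y) →
                (∀ {i j} (p : i ∈ X) (q : j ∈ X) → g p ≡ g q → i ≡ j) → ∣ X ∣ ≤ ∣ Y ∣
injection⇒∣∣≤ {X = X} g g∈ inj = injective⇒≤ {f = λ k → rank (g∈ (pick-∈ X k))}
  λ eq → pick-injective X (inj (pick-∈ X _) (pick-∈ X _) (rank-injective (g∈ _) (g∈ _) eq))

∣p∪q∣≤∣p∣+∣q∣ : (X Y : Subset n) → ∣ X ∪ Y ∣ ≤ ∣ X ∣ + ∣ Y ∣
∣p∪q∣≤∣p∣+∣q∣ []            []            = z≤n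
∣p∪q∣≤∣p∣+∣q∣ (outside ∷ X) (outside ∷ Y) = ∣p∪q∣≤∣p∣+∣q∣ X Y
∣p∪q∣≤∣p∣+∣q∣ (outside ∷ X) (inside  ∷ Y) =
  ≤-trans (s≤s (∣p∪q∣≤∣p∣+∣q∣ X Y)) (≤-reflexive (sym (+-suc ∣ X ∣ ∣ Y ∣)))
∣p∪q∣≤∣p∣+∣q∣ (inside  ∷ X) (outside ∷ Y) = s≤s (∣p∪q∣≤∣p∣+∣q∣ X Y)
∣p∪q∣≤∣p∣+∣q∣ (inside  ∷ X) (inside  ∷ Y) =
  s≤s (≤-trans (∣p∪q∣≤∣p∣+∣q∣ X Y) (+-monoʳ-≤ ∣ X ∣ (n≤1+n ∣ Y ∣)))

-- Images and preimages of vertex sets and of cliques.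

does⁻ : {A : Set} (d : Dec A) → does d ≡ true → A
does⁻ (yes a) _ = a

module _ {P : Fin n → Set} (P? : Decidable P) where

  ⟦_⟧ : Subset n
  ⟦_⟧ = tabulate (does ∘ P?)

  ∈⟦⟧⁺ : P i → i ∈ ⟦_⟧
  ∈⟦⟧⁺ {i} p = lookup⇒[]= i _ (trans (lookup∘tabulate _ i) (dec-true (P? i) p))

  ∈⟦⟧⁻ : i ∈ ⟦_⟧ → P i
  ∈⟦⟧⁻ {i} p = does⁻ (P? i) (trans (sym (lookup∘tabulate _ i)) ([]=⇒lookup p))

module _ (f : Fin m → Fin n) where

  private
    inImage? : (X : Subset m) → Decidable (λ j → ∃ λ i → i ∈ X × f i ≡ j)
    inImage? X j = any? λ i → (i ∈? X) ×-dec (f i ≟ j)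

  image : Subset m → Subset n
  image X = ⟦ inImage? X ⟧

  ∈-image⁺ : {X : Subset m} → i ∈ X → f i ∈ image X
  ∈-image⁺ {X = X} p = ∈⟦⟧⁺ (inImage? X) (_ , p , refl)

  ∈-image⁻ : {X : Subset m} → j ∈ image X → ∃ λ i → i ∈ X × f i ≡ j
  ∈-image⁻ {X = X} = ∈⟦⟧⁻ (inImage? X)

  preimage : Subset n → Subset m
  preimage Y = ⟦ (λ i → f i ∈? Y) ⟧

  ∈-preimage⁺ : {Y : Subset n} → f i ∈ Y → i ∈ preimage Y
  ∈-preimage⁺ {Y = Y} = ∈⟦⟧⁺ (λ i → f i ∈? Y)

  ∈-preimage⁻ : {Y : Subset n} → i ∈ preimage Y → f i ∈ Y
  ∈-preimage⁻ {Y = Y} = ∈⟦⟧⁻ (λ i → f i ∈? Y)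

  -- Exhibits a set inside the range of `f` as an image. This is how cliques of an enlarged graph
  -- are traced back to cliques of its pieces.
  image-preimage : {Y : Subset n} → (∀ {j} → j ∈ Y → ∃ λ i → f i ≡ j) → image (preimage Y) ≡ Y
  image-preimage {Y} onto = ⊆-antisym
    (λ p → let _ , q , eq = ∈-image⁻ p in subst (_∈ Y) eq (∈-preimage⁻ q))
    (λ p → let _ , eq = onto p in
      subst (_∈ image (preimage Y)) eq (∈-image⁺ (∈-preimage⁺ (subst (_∈ Y) (sym eq) p))))

  module _ (f-injective : Injective _≡_ _≡_ f) where

    ∈-image-injective : {X : Subset m} → f i ∈ image X → i ∈ X
    ∈-image-injective {X = X} p = let _ , q , eq = ∈-image⁻ p in subst (_∈ X) (f-injective eq) q

    image-injective : Injective _≡_ _≡_ image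
    image-injective {X} {Y} eq = ⊆-antisym
      (λ p → ∈-image-injective (subst (_ ∈_) eq (∈-image⁺ p)))
      (λ p → ∈-image-injective (subst (_ ∈_) (sym eq) (∈-image⁺ p)))

    ∣image∣ : (X : Subset m) → ∣ image X ∣ ≡ ∣ X ∣
    ∣image∣ X = ≤-antisym
      (injection⇒∣∣≤ (λ p → proj₁ (∈-image⁻ p)) (λ p → proj₁ (proj₂ (∈-image⁻ p)))
        λ p q eq → trans (sym (proj₂ (proj₂ (∈-image⁻ p))))
                     (trans (cong f eq) (proj₂ (proj₂ (∈-image⁻ q)))))
      (injection⇒∣∣≤ (λ {i} _ → f i) ∈-image⁺ λ _ _ → f-injective)

    clique-image : (H : Graph m) (G : Graph n) → (∀ {i j} → Adj H i j → Adj G (f i) (f j)) →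
                   {X : Subset m} → IsClique H t X → IsClique G t (image X)
    clique-image H G edge {X} (size , adj) = trans (∣image∣ X) size , λ i j p q i≢j →
      let _ , p′ , eqᵢ = ∈-image⁻ p
          _ , q′ , eqⱼ = ∈-image⁻ q
      in subst₂ (Adj G) eqᵢ eqⱼ
           (edge (adj _ _ p′ q′ λ eq → i≢j (trans (sym eqᵢ) (trans (cong f eq) eqⱼ))))

    clique-preimage : (H : Graph m) (G : Graph n) {Y : Subset n} →
      (∀ {j} → j ∈ Y → ∃ λ i → f i ≡ j) →
      (∀ {i j} → f i ∈ Y → f j ∈ Y → Adj G (f i) (f j) → Adj H i j) →
      IsClique G t Y → IsClique H t (preimage Y)
    clique-preimage H G {Y} onto reflect (size , adj) =
      trans (sym (∣image∣ (preimage Y))) (trans (cong ∣_∣ (image-preimage onto)) size) ,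
      λ i j p q i≢j → reflect (∈-preimage⁻ p) (∈-preimage⁻ q)
        (adj _ _ (∈-preimage⁻ p) (∈-preimage⁻ q) (i≢j ∘ f-injective))

-- Cliques inside a vertex set and cliques meeting one.

cliquesIn : (G : Graph n) (t : ℕ) → Subset n → List (Subset n)
cliquesIn {n} G t U = filter (λ Q → isClique? G t Q ×-dec (Q ⊆? U)) (subsets n)

cliquesMeeting : (H : Graph h) (t : ℕ) → Subset h → List (Subset h)
cliquesMeeting {h} H t S = filter (λ Q → isClique? H t Q ×-dec nonempty? (Q ∩ S)) (subsets h)

-- The number w(S) of the overview.
weight : (H : Graph h) (t : ℕ) → Subset h → ℕ
weight H t S = length (cliquesMeeting H t S)

module _ {P : Subset n → Set} (P? : Decidable P) where

  filter-subsets-unique : Unique (filter P? (subsets n))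
  filter-subsets-unique = Unique.filter⁺ P? (subsets-unique n)

  ∈-filter-subsets : {X : Subset n} → P X → X ∈ˡ filter P? (subsets n)
  ∈-filter-subsets p = ∈-filter⁺ P? (∈-subsets _) p

  filter-subsets⁻ : {X : Subset n} → X ∈ˡ filter P? (subsets n) → P X
  filter-subsets⁻ = proj₂ ∘ ∈-filter⁻ P? {xs = subsets n}

-- Lower bound: exhausting a covered graph by copies of H.

module _ (H : Graph h) (G : Graph n) (t : ℕ) (c : Copy H G) (U : Subset n) where

  private
    f = vertex c
    in? : (V : Subset n) → Decidable (λ Q → IsClique G t Q × Q ⊆ V)
    in? V Q = isClique? G t Q ×-dec (Q ⊆? V)
    meets? : (S : Subset h) → Decidable (λ Q → IsClique H t Q × Nonempty (Q ∩ S))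
    meets? S Q = isClique? H t Q ×-dec nonempty? (Q ∩ S)

  -- The set S of the overview: it lives in H, and its image under `f` is what the copy adds to `U`.
  uncovered : Subset h
  uncovered = ∁ (preimage f U)

  extend : Subset n
  extend = U ∪ image f uncovered

  copy⊆extend : ∀ i → f i ∈ extend
  copy⊆extend i with f i ∈? U
  ... | yes p = x∈p∪q⁺ (inj₁ p)
  ... | no ¬p = x∈p∪q⁺ (inj₂ (∈-image⁺ f (x∉p⇒x∈∁p (¬p ∘ ∈-preimage⁻ f))))

  ∣extend∣≤ : ∣ extend ∣ ≤ ∣ U ∣ + ∣ uncovered ∣
  ∣extend∣≤ = ≤-trans (∣p∪q∣≤∣p∣+∣q∣ U _)
    (≤-reflexive (cong (∣ U ∣ +_) (∣image∣ f (injective c) uncovered)))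

  -- A clique of H that meets `uncovered` is carried by the copy to a clique of G inside `extend`.
  -- Different cliques have different images because the copy is injective, so it remains to
  -- separate these images from the cliques already inside `U`.
  cliquesIn-extend : length (cliquesIn G t U) + weight H t uncovered ≤ length (cliquesIn G t extend)
  cliquesIn-extend = begin
    length old + length (cliquesMeeting H t uncovered)
      ≡⟨ cong (length old +_) (sym (length-map (image f) (cliquesMeeting H t uncovered))) ⟩
    length old + length new
      ≡⟨ sym (length-++ old) ⟩
    length (old ++ new)
      ≤⟨ unique-⊆⇒length≤
           (Unique.++⁺ (filter-subsets-unique (in? U))
             (Unique.map⁺ (image-injective f (injective c)) (filter-subsets-unique (meets? uncovered)))
             disjoint′)
           (λ p → Sum.[ fromOld , fromNew ] (∈-++⁻ old p)) ⟩
    length (cliquesIn G t extend) ∎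
    where
    open ≤-Reasoning
    old = cliquesIn G t U
    new = map (image f) (cliquesMeeting H t uncovered)
    -- A common clique would lie inside `U` and yet contain the image of a vertex in `uncovered`.
    disjoint′ : ∀ {Q} → ¬ (Q ∈ˡ old × Q ∈ˡ new)
    disjoint′ (p , q) with ∈-map⁻ (image f) q
    ... | R , r , refl =
      let _ , i , i∈ = filter-subsets⁻ (meets? uncovered) r
          i∈R , i∈S  = x∈p∩q⁻ R uncovered i∈
      in x∈∁p⇒x∉p i∈S (∈-preimage⁺ f (proj₂ (filter-subsets⁻ (in? U) p) (∈-image⁺ f i∈R)))
    fromOld : ∀ {Q} → Q ∈ˡ old → Q ∈ˡ cliquesIn G t extend
    fromOld p = let cl , sub = filter-subsets⁻ (in? U) p in
      ∈-filter-subsets (in? extend) (cl , λ x → x∈p∪q⁺ (inj₁ (sub x)))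
    fromNew : ∀ {Q} → Q ∈ˡ new → Q ∈ˡ cliquesIn G t extend
    fromNew q with ∈-map⁻ (image f) q
    ... | R , r , refl = ∈-filter-subsets (in? extend)
      ( clique-image f (injective c) H G (edge c) (proj₁ (filter-subsets⁻ (meets? uncovered) r))
      , λ x → let i , _ , eq = ∈-image⁻ f x in subst (_∈ extend) eq (copy⊆extend i))

module _ (H : Graph h) (G : Graph n) (t w s : ℕ)
         (w≤ : ∀ S → w * ∣ S ∣ ≤ weight H t S * s) (cov : Covered H G) where

  -- Induction on the list of vertices to be reached. The hypothesis `w≤` says w / s ≤ w(S) / |S|
  -- with denominators cleared, and in this form it also holds for empty S. Hence a vertex that is
  -- already in `U` is processed like any other.
  cover : (vs : List (Fin n)) → ∃ λ U → All (_∈ U) vs × w * ∣ U ∣ ≤ length (cliquesIn G t U) * s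
  cover []       = ⊥ , [] , ≤-trans (≤-reflexive (trans (cong (w *_) (∣⊥∣≡0 n)) (*-zeroʳ w))) z≤n
  cover (v ∷ vs) with cover vs
  ... | U , all , bound with cov v
  ... | c , i , refl = extend H G t c U
    , copy⊆extend H G t c U i ∷ All.map (λ x → x∈p∪q⁺ (inj₁ x)) all
    , (begin
      w * ∣ extend H G t c U ∣
        ≤⟨ *-monoʳ-≤ w (∣extend∣≤ H G t c U) ⟩
      w * (∣ U ∣ + ∣ S ∣)
        ≡⟨ *-distribˡ-+ w ∣ U ∣ ∣ S ∣ ⟩
      w * ∣ U ∣ + w * ∣ S ∣
        ≤⟨ +-mono-≤ bound (w≤ S) ⟩
      length (cliquesIn G t U) * s + weight H t S * s
        ≡⟨ sym (*-distribʳ-+ s (length (cliquesIn G t U)) (weight H t S)) ⟩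
      (length (cliquesIn G t U) + weight H t S) * s
        ≤⟨ *-monoˡ-≤ s (cliquesIn-extend H G t c U) ⟩
      length (cliquesIn G t (extend H G t c U)) * s ∎)
    where
    open ≤-Reasoning
    S = uncovered H G t c U

  -- Reaching every vertex forces `U` to be the whole vertex set, and the cliques inside `U` are
  -- among all cliques of G.
  #K-lower : w * n ≤ #K t G * s
  #K-lower with cover (allFin n)
  ... | U , all , bound = begin
    w * n                         ≡⟨ cong (w *_) (sym (∣⊤∣≡n n)) ⟩
    w * ∣ ⊤ {n} ∣                 ≤⟨ *-monoʳ-≤ w (p⊆q⇒∣p∣≤∣q∣ {p = ⊤} {q = U}
                                       λ {x} _ → All.lookup all (∈-allFin x)) ⟩
    w * ∣ U ∣                     ≤⟨ bound ⟩
    length (cliquesIn G t U) * s  ≤⟨ *-monoˡ-≤ s (unique-⊆⇒length≤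
                                       (filter-subsets-unique in?)
                                       λ p → ∈-filter-subsets (isClique? G t) (proj₁ (filter-subsets⁻ in? p))) ⟩
    #K t G * s ∎
    where
    open ≤-Reasoning
    in? : Decidable (λ Q → IsClique G t Q × Q ⊆ U)
    in? Q = isClique? G t Q ×-dec (Q ⊆? U)

-- Upper bound: attaching a fresh clone of S to the rest of H.

↑ˡ≢↑ʳ : ∀ {i : Fin m} {j : Fin n} → i ↑ˡ n ≢ m ↑ʳ j
↑ˡ≢↑ʳ {m} {n} {i} {j} eq with trans (sym (splitAt-↑ˡ m i n)) (trans (cong (splitAt m) eq) (splitAt-↑ʳ m n j))
... | ()

splitCase : ∀ m {n} (v : Fin (m + n)) → (∃ λ i → i ↑ˡ n ≡ v) ⊎ (∃ λ j → m ↑ʳ j ≡ v)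
splitCase m v with splitAt m v in eq
... | inj₁ i = inj₁ (i , splitAt⁻¹-↑ˡ eq)
... | inj₂ j = inj₂ (j , splitAt⁻¹-↑ʳ eq)

-- Vertices outside the range of `f` are isolated. An edge carries the edge of `G` that it comes
-- from, so its origin can be recovered by pattern matching.
pushforward : (f : Fin m → Fin n) → Injective _≡_ _≡_ f → Graph m → Graph n
pushforward f f-injective G = record
  { Adj         = λ u v → ∃ λ i → ∃ λ j → f i ≡ u × f j ≡ v × Adj G i j
  ; Adj?        = λ u v → any? λ i → any? λ j → (f i ≟ u) ×-dec ((f j ≟ v) ×-dec Adj? G i j)
  ; symmetric   = λ (i , j , p , q , a) → j , i , q , p , symmetric G a
  ; irreflexive = λ u≡v (i , j , p , q , a) → irreflexive G (f-injective (trans p (trans u≡v (sym q)))) a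
  }

overlay : Graph n → Graph n → Graph n
overlay G G′ = record
  { Adj         = λ u v → Adj G u v ⊎ Adj G′ u v
  ; Adj?        = λ u v → Adj? G u v ⊎-dec Adj? G′ u v
  ; symmetric   = Sum.map (symmetric G) (symmetric G′)
  ; irreflexive = λ eq → Sum.[ irreflexive G eq , irreflexive G′ eq ]
  }

-- The anchor is the copy of H to which clones are attached.  It has to be induced,
-- so that a clique containing a clone is a clique of H.
record Anchored (H : Graph h) (t n k : ℕ) : Set₁ where
  field
    graph    : Graph n
    anchor   : Copy H graph
    induced  : ∀ {i j} → Adj graph (vertex anchor i) (vertex anchor j) → Adj H i j
    covered  : Covered H graph
    cliques≤ : #K t graph ≤ k

module Clone {H : Graph h} (S : Subset h) (A : Anchored H t n k) where

  open Anchored A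

  private
    old : Fin n → Fin (n + ∣ S ∣)
    old = _↑ˡ ∣ S ∣
    new : Fin ∣ S ∣ → Fin (n + ∣ S ∣)
    new = n ↑ʳ_
    old-injective : Injective _≡_ _≡_ old
    old-injective = ↑ˡ-injective ∣ S ∣ _ _
    c = vertex anchor

    -- The decision is an argument so that `place-view` can match on it; `view` then describes `c′`
    -- without evaluating `i ∈? S`.
    place : ∀ {i} → Dec (i ∈ S) → Fin (n + ∣ S ∣)
    place     (yes p) = new (rank p)
    place {i} (no _)  = old (c i)

    -- The new copy of H: fresh clones for S, shared anchor vertices for the rest.
    c′ : Fin h → Fin (n + ∣ S ∣)
    c′ i = place (i ∈? S)

    place-view : (d : Dec (i ∈ S)) →
                 (∃ λ (p : i ∈ S) → place d ≡ new (rank p)) ⊎ (i ∉ S × place d ≡ old (c i))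
    place-view (yes p) = inj₁ (p , refl)
    place-view (no ¬p) = inj₂ (¬p , refl)

    view : ∀ i → (∃ λ (p : i ∈ S) → c′ i ≡ new (rank p)) ⊎ (i ∉ S × c′ i ≡ old (c i))
    view i = place-view (i ∈? S)

    c′-injective : Injective _≡_ _≡_ c′
    c′-injective {i} {j} eq with view i | view j
    ... | inj₁ (p , eqᵢ) | inj₁ (q , eqⱼ) =
      rank-injective p q (↑ʳ-injective n _ _ (trans (sym eqᵢ) (trans eq eqⱼ)))
    ... | inj₁ (_ , eqᵢ) | inj₂ (_ , eqⱼ) = contradiction (trans (sym eqⱼ) (trans (sym eq) eqᵢ)) ↑ˡ≢↑ʳ
    ... | inj₂ (_ , eqᵢ) | inj₁ (_ , eqⱼ) = contradiction (trans (sym eqᵢ) (trans eq eqⱼ)) ↑ˡ≢↑ʳ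
    ... | inj₂ (_ , eqᵢ) | inj₂ (_ , eqⱼ) = injective anchor (old-injective (trans (sym eqᵢ) (trans eq eqⱼ)))

    c′-old : {v : Fin n} → c′ i ≡ old v → c i ≡ v
    c′-old {i} eq with view i
    ... | inj₁ (_ , eq′) = contradiction (trans (sym eq) eq′) ↑ˡ≢↑ʳ
    ... | inj₂ (_ , eq′) = old-injective (trans (sym eq′) eq)

    c′-onto-new : ∀ l → c′ (pick S l) ≡ new l
    c′-onto-new l with view (pick S l)
    ... | inj₁ (p , eq) = trans eq (cong new (pick-injective S (pick-rank p)))
    ... | inj₂ (¬p , _) = contradiction (pick-∈ S l) ¬p

  cloned : Graph (n + ∣ S ∣)
  cloned = overlay (pushforward old old-injective graph) (pushforward c′ c′-injective H)

  private
    -- The new copy adds no edge between old vertices: where `c′` hits an old vertex it agrees with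
    -- the anchor, which already has that edge.
    old-reflect : {u v : Fin n} → Adj cloned (old u) (old v) → Adj graph u v
    old-reflect (inj₁ (_ , _ , p , q , a)) = subst₂ (Adj graph) (old-injective p) (old-injective q) a
    old-reflect (inj₂ (_ , _ , p , q , a)) = subst₂ (Adj graph) (c′-old p) (c′-old q) (edge anchor a)

    -- The new copy is induced too. An edge of the old graph between two of its vertices joins
    -- anchor vertices, so `induced` makes it an edge of H.
    c′-reflect : Adj cloned (c′ i) (c′ j) → Adj H i j
    c′-reflect (inj₁ (_ , _ , p , q , a)) =
      induced (subst₂ (Adj graph) (sym (c′-old (sym p))) (sym (c′-old (sym q))) a)
    c′-reflect (inj₂ (_ , _ , p , q , a)) = subst₂ (Adj H) (c′-injective p) (c′-injective q) a

    new-neighbour : {l : Fin ∣ S ∣} {v : Fin (n + ∣ S ∣)} → Adj cloned (new l) v → ∃ λ j → c′ j ≡ v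
    new-neighbour (inj₁ (_ , _ , p , _))     = contradiction p ↑ˡ≢↑ʳ
    new-neighbour (inj₂ (_ , j , _ , q , _)) = j , q

    lift : Copy H graph → Copy H cloned
    lift d = record
      { vertex    = old ∘ vertex d
      ; injective = injective d ∘ old-injective
      ; edge      = λ a → inj₁ (_ , _ , refl , refl , edge d a)
      }

    cov′ : Covered H cloned
    cov′ v with splitCase n v
    ... | inj₁ (u , refl) = let d , i , eq = covered u in lift d , i , cong old eq
    ... | inj₂ (l , refl) =
      record { vertex = c′ ; injective = c′-injective ; edge = λ a → inj₂ (_ , _ , refl , refl , a) }
      , pick S l , c′-onto-new l

    meets? : Decidable (λ Q → IsClique H t Q × Nonempty (Q ∩ S))
    meets? Q = isClique? H t Q ×-dec nonempty? (Q ∩ S)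

    candidates : List (Subset (n + ∣ S ∣))
    candidates = map (image old) (filter (isClique? graph t) (subsets n))
              ++ map (image c′) (cliquesMeeting H t S)

    -- A new vertex has all its neighbours in the new copy c′ of H.
    clique-origin : {X : Subset (n + ∣ S ∣)} → IsClique cloned t X → X ∈ˡ candidates
    clique-origin {X} cl@(_ , adj) with any? (λ l → new l ∈? X)
    ... | no ¬new = ∈-++⁺ˡ (subst (_∈ˡ _) (image-preimage old onto)
      (∈-map⁺ (image old) (∈-filter-subsets (isClique? graph t)
        (clique-preimage old old-injective graph cloned onto (λ _ _ → old-reflect) cl))))
      where
      onto : ∀ {v} → v ∈ X → ∃ λ u → old u ≡ v
      onto {v} p with splitCase n v
      ... | inj₁ q          = q
      ... | inj₂ (l , refl) = contradiction (l , p) ¬new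
    ... | yes (l , l∈X) = ∈-++⁺ʳ (map (image old) _) (subst (_∈ˡ _) (image-preimage c′ onto)
      (∈-map⁺ (image c′) (∈-filter-subsets meets?
        ( clique-preimage c′ c′-injective H cloned onto (λ _ _ → c′-reflect) cl
        , pick S l , x∈p∩q⁺ (∈-preimage⁺ c′ (subst (_∈ X) (sym (c′-onto-new l)) l∈X) , pick-∈ S l)))))
      where
      onto : ∀ {v} → v ∈ X → ∃ λ j → c′ j ≡ v
      onto {v} p with new l ≟ v
      ... | yes eq = pick S l , trans (c′-onto-new l) eq
      ... | no ¬eq = new-neighbour (adj _ _ l∈X p ¬eq)

    #K-clone : #K t cloned ≤ k + weight H t S
    #K-clone = begin
      #K t cloned
        ≤⟨ unique-⊆⇒length≤ (filter-subsets-unique (isClique? cloned t))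
             (clique-origin ∘ filter-subsets⁻ (isClique? cloned t)) ⟩
      length candidates
        ≡⟨ trans (length-++ (map (image old) (filter (isClique? graph t) (subsets n))))
             (cong₂ _+_ (length-map (image old) (filter (isClique? graph t) (subsets n)))
                        (length-map (image c′) (cliquesMeeting H t S))) ⟩
      #K t graph + weight H t S
        ≤⟨ +-monoˡ-≤ _ cliques≤ ⟩
      k + weight H t S ∎
      where open ≤-Reasoning

  -- The anchor is still the original copy, and by `old-reflect` still induced, so cloning can be
  -- repeated with the same or another S at the price w(S) each time.
  clone : Anchored H t (n + ∣ S ∣) (k + weight H t S)
  clone = record
    { graph    = cloned
    ; anchor   = lift anchor
    ; induced  = induced ∘ old-reflect
    ; covered  = cov′
    ; cliques≤ = #K-clone
    }

self-anchored : (H : Graph h) (t : ℕ) → Anchored H t h (#K t H)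
self-anchored H t = record
  { graph    = H
  ; anchor   = idCopy
  ; induced  = id
  ; covered  = λ v → idCopy , v , refl
  ; cliques≤ = ≤-refl
  }
  where
  idCopy : Copy H H
  idCopy = record { vertex = id ; injective = id ; edge = id }

clones : {H : Graph h} (S : Subset h) (m : ℕ) → Anchored H t n k →
         Anchored H t (n + m * ∣ S ∣) (k + m * weight H t S)
clones {t = t} {n} {k} {H} S zero    A = subst₂ (Anchored H t) (sym (+-identityʳ n)) (sym (+-identityʳ k)) A
clones {t = t} {n} {k} {H} S (suc m) A =
  subst₂ (Anchored H t) (+-assoc n ∣ S ∣ (m * ∣ S ∣)) (+-assoc k (weight H t S) (m * weight H t S))
    (clones S m (Clone.clone S A))

-- The optimal set and the resulting bound on cov.

*-swapʳ : ∀ a b c → a * b * c ≡ a * c * b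
*-swapʳ = solve-∀

module _ {A : Set} (f g : A → ℕ) where

  -- Minimises f / g over the entries with g positive, with fractions compared by
  -- cross-multiplication. An entry with g x = 0 passes the comparison as 0 ≤ 0 or better, so it
  -- never replaces the current minimiser.
  best-ratio : (a₀ : A) → 0 < g a₀ → (xs : List A) →
               ∃ λ a → 0 < g a × All (λ x → f a * g x ≤ f x * g a) xs
  best-ratio a₀ pos []       = a₀ , pos , []
  best-ratio a₀ pos (x ∷ xs) with best-ratio a₀ pos xs
  ... | a , 0<ga , all with f a * g x ≤? f x * g a
  ...   | yes a≤x = a , 0<ga , a≤x ∷ all
  ...   | no  a≰x = x , 0<gx , ≤-refl ∷ All.map improve all
    where
    x<a : f x * g a < f a * g x
    x<a = ≰⇒> a≰x
    0<gx : 0 < g x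
    0<gx = n≢0⇒n>0 λ gx≡0 → n≮0 (subst (f x * g a <_) (trans (cong (f a *_) gx≡0) (*-zeroʳ (f a))) x<a)
    -- Transitivity of the comparison of fractions, after multiplying by the positive `g a`.
    improve : ∀ {y} → f a * g y ≤ f y * g a → f x * g y ≤ f y * g x
    improve {y} a≤y = *-cancelʳ-≤ _ _ (g a) {{>-nonZero 0<ga}} (begin
      f x * g y * g a  ≡⟨ *-swapʳ (f x) (g y) (g a) ⟩
      f x * g a * g y  ≤⟨ *-monoˡ-≤ (g y) (<⇒≤ x<a) ⟩
      f a * g x * g y  ≡⟨ *-swapʳ (f a) (g x) (g y) ⟩
      f a * g y * g x  ≤⟨ *-monoˡ-≤ (g x) a≤y ⟩
      f y * g a * g x  ≡⟨ *-swapʳ (f y) (g a) (g x) ⟩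
      f y * g x * g a  ∎)
      where open ≤-Reasoning

cheapest : (H : Graph (suc h)) (t : ℕ) →
           ∃ λ S → 0 < ∣ S ∣ × (∀ T → weight H t S * ∣ T ∣ ≤ weight H t T * ∣ S ∣)
-- The search starts at `⊤`, which is nonempty because H has a vertex.
cheapest {h} H t =
  let S , pos , all = best-ratio (weight H t) ∣_∣ ⊤ (subst (0 <_) (sym (∣⊤∣≡n (suc h))) z<s)
                                 (subsets (suc h))
  in S , pos , λ T → All.lookup all (∈-subsets T)

-- Write N - (h + 1) = m s + r by division with remainder. Starting from H, r clones of the single
-- vertex `zero` and m clones of S give exactly N vertices.
cov-upper : (H : Graph (suc h)) (t : ℕ) (S : Subset (suc h)) .{{_ : NonZero ∣ S ∣}} →
  ∃ λ D → ∀ N (h≤N : suc h ≤ N) → cov t N H h≤N * ∣ S ∣ ≤ weight H t S * N + D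
-- D pays for the cliques of H and for at most s single-vertex clones, multiplied by s as in the
-- cleared inequality.
cov-upper {h} H t S = (#K t H + s * w₁) * s , λ N h≤N →
  let d = N ∸ suc h
      r = d % s
      m = d / s
      N≡ : suc h + r * ∣ ⁅ zero {h} ⁆ ∣ + m * s ≡ N
      N≡ = begin-equality
        suc h + r * ∣ ⁅ zero {h} ⁆ ∣ + m * s ≡⟨ cong (λ x → suc h + r * x + m * s) (∣⁅x⁆∣≡1 (zero {h})) ⟩
        suc h + r * 1 + m * s                ≡⟨ cong (λ x → suc h + x + m * s) (*-identityʳ r) ⟩
        suc h + r + m * s                    ≡⟨ +-assoc (suc h) r (m * s) ⟩
        suc h + (r + m * s)                  ≡⟨ cong (λ x → suc h + x) (sym (m≡m%n+[m/n]*n d s)) ⟩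
        suc h + (N ∸ suc h)                  ≡⟨ m+[n∸m]≡n h≤N ⟩
        N                                    ∎
      A = subst (λ n → Anchored H t n (#K t H + r * w₁ + m * w)) N≡
            (clones S m (clones ⁅ zero ⁆ r (self-anchored H t)))
  in begin
    cov t N H h≤N * s
      ≤⟨ *-monoˡ-≤ s (≤-trans (IsCov.minimal (cov-isCov t N H h≤N) (Anchored.graph A) (Anchored.covered A))
                              (Anchored.cliques≤ A)) ⟩
    (#K t H + r * w₁ + m * w) * s
      ≡⟨ regroup (#K t H) (r * w₁) m w s ⟩
    w * (m * s) + (#K t H + r * w₁) * s
      ≤⟨ +-mono-≤
           (*-monoʳ-≤ w (≤-trans (m≤n+m (m * s) _) (≤-reflexive N≡)))
           (*-monoˡ-≤ s (+-monoʳ-≤ (#K t H) (*-monoˡ-≤ w₁ (m%n≤n d s)))) ⟩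
    w * N + (#K t H + s * w₁) * s ∎
  where
  open ≤-Reasoning
  s  = ∣ S ∣
  w  = weight H t S
  w₁ = weight H t ⁅ zero ⁆
  regroup : ∀ a b m w s → (a + b + m * w) * s ≡ w * (m * s) + (a + b) * s
  regroup = solve-∀

-- Rational limits and the O(1) error estimate.

fromℚ : ℚ → ℝ
fromℚ r = record
  { Lower           = ℚ._< r
  ; Upper           = r ℚ.<_
  ; lower-inhabited = r ℚ.- ℚ.1ℚ ,
      subst (r ℚ.- ℚ.1ℚ ℚ.<_) (ℚ.+-identityʳ r) (ℚ.+-monoʳ-< r (ℚ.negative⁻¹ (ℚ.- ℚ.1ℚ)))
  ; upper-inhabited = r ℚ.+ ℚ.1ℚ ,
      subst (ℚ._< r ℚ.+ ℚ.1ℚ) (ℚ.+-identityʳ r) (ℚ.+-monoʳ-< r (ℚ.positive⁻¹ ℚ.1ℚ))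
  ; lower-rounded   = λ p → mk⇔ ℚ.<-dense λ (_ , p<q , q<r) → ℚ.<-trans p<q q<r
  ; upper-rounded   = λ q → mk⇔ (λ r<q → let p , r<p , p<q = ℚ.<-dense r<q in p , p<q , r<p)
                                λ (_ , p<q , r<p) → ℚ.<-trans r<p p<q
  ; disjoint        = λ _ (q<r , r<q) → ℚ.<-asym q<r r<q
  ; located         = λ p q p<q → Sum.map id (λ p≮r → ℚ.≤-<-trans (ℚ.≮⇒≥ p≮r) p<q) (toSum (p ℚ.<? r))
  }

-- The ratios stay at or above their limit, so only the upper estimate has to be made small.
∣-fromℚ∣< : ∀ {a r ε} → 0ℚ ℚ.< ε → r ℚ.≤ a → a ℚ.< r ℚ.+ ε → ∣ a - fromℚ r ∣< ε
∣-fromℚ∣< {a} {r} {ε} 0<ε r≤a a<r+ε =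
    subst (a ℚ.- ε ℚ.<_)
      (trans (ℚ.+-assoc r ε (ℚ.- ε)) (trans (cong (r ℚ.+_) (ℚ.+-inverseʳ ε)) (ℚ.+-identityʳ r)))
      (ℚ.+-monoˡ-< (ℚ.- ε) a<r+ε)
  , subst (ℚ._< a ℚ.+ ε) (ℚ.+-identityʳ r) (ℚ.+-mono-≤-< r≤a 0<ε)

/-mono-≤ : ∀ w c s N .{{_ : NonZero s}} .{{_ : NonZero N}} → w * N ≤ c * s → ℤ.+ w ℚ./ s ℚ.≤ ℤ.+ c ℚ./ N
-- Unnormalised rationals compare by cross-multiplication. `mkℚᵘ` stores the denominator minus one,
-- hence `s` and `N` for `suc s` and `suc N`.
/-mono-≤ w c (suc s) (suc N) le = ℚ.toℚᵘ-cancel-≤ (begin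
  ℚ.toℚᵘ (ℤ.+ w ℚ./ suc s)  ≃⟨ ℚ.toℚᵘ-fromℚᵘ (mkℚᵘ (ℤ.+ w) s) ⟩
  mkℚᵘ (ℤ.+ w) s            ≤⟨ ℚᵘ.*≤* (subst₂ ℤ._≤_ (ℤ.pos-* w (suc N)) (ℤ.pos-* c (suc s)) (ℤ.+≤+ le)) ⟩
  mkℚᵘ (ℤ.+ c) N            ≃⟨ ℚ.toℚᵘ-fromℚᵘ (mkℚᵘ (ℤ.+ c) N) ⟨
  ℚ.toℚᵘ (ℤ.+ c ℚ./ suc N)  ∎)
  where open ℚᵘ.≤-Reasoning

-- Dividing the bound by s N leaves the error D / (s N). For ε = p / q it is below ε as soon as D q
-- < p s N, and D q < N suffices since p and s are at least 1.
/-<-+ : ∀ w c D s N .{{_ : NonZero s}} .{{_ : NonZero N}} {ε} → 0ℚ ℚ.< ε → c * s ≤ w * N + D →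
        D * ℚ.↧ₙ ε < N → ℤ.+ c ℚ./ N ℚ.< ℤ.+ w ℚ./ s ℚ.+ ε
/-<-+ w c D (suc s) (suc N) {ε@(mkℚ (ℤ.+ suc p) q-1 _)} 0<ε le D<N = ℚ.toℚᵘ-cancel-< (begin-strict
  ℚ.toℚᵘ (ℤ.+ c ℚ./ suc N)                 ≃⟨ ℚ.toℚᵘ-fromℚᵘ (mkℚᵘ (ℤ.+ c) N) ⟩
  mkℚᵘ (ℤ.+ c) N                           <⟨ ℚᵘ.*<* cross ⟩
  mkℚᵘ (ℤ.+ w) s ℚᵘ.+ ℚ.toℚᵘ ε             ≃⟨ ℚᵘ.+-congˡ (ℚ.toℚᵘ ε) (ℚ.toℚᵘ-fromℚᵘ (mkℚᵘ (ℤ.+ w) s)) ⟨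
  ℚ.toℚᵘ (ℤ.+ w ℚ./ suc s) ℚᵘ.+ ℚ.toℚᵘ ε   ≃⟨ ℚ.toℚᵘ-homo-+ (ℤ.+ w ℚ./ suc s) ε ⟨
  ℚ.toℚᵘ (ℤ.+ w ℚ./ suc s ℚ.+ ε)           ∎)
  where
  open ℚᵘ.≤-Reasoning
  q = suc q-1
  regroup : ∀ n d → (w * n + d) * q ≡ w * q * n + d * q
  regroup n d = trans (*-distribʳ-+ q (w * n) d) (cong (_+ d * q) (*-swapʳ w n q))
  natural : c * (suc s * q) < (w * q + suc p * suc s) * suc N
  natural = N.begin-strict
    c * (suc s * q)                       N.≡⟨ *-assoc c (suc s) q ⟨
    c * suc s * q                         N.≤⟨ *-monoˡ-≤ q le ⟩
    (w * suc N + D) * q                   N.≡⟨ regroup (suc N) D ⟩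
    w * q * suc N + D * q                 N.<⟨ +-monoʳ-< (w * q * suc N) D<N ⟩
    w * q * suc N + suc N                 N.≤⟨ +-monoʳ-≤ (w * q * suc N) (m≤n*m (suc N) (suc p * suc s)) ⟩
    w * q * suc N + suc p * suc s * suc N N.≡⟨ *-distribʳ-+ (suc N) (w * q) (suc p * suc s) ⟨
    (w * q + suc p * suc s) * suc N       N.∎
    where module N = ≤-Reasoning
  cross : ℤ.+ c ℤ.* ℤ.+ (suc s * q) ℤ.< (ℤ.+ w ℤ.* ℤ.+ q ℤ.+ ℤ.+ suc p ℤ.* ℤ.+ suc s) ℤ.* ℤ.+ suc N
  cross = subst₂ ℤ._<_ (ℤ.pos-* c (suc s * q))
    (trans (ℤ.pos-* (w * q + suc p * suc s) (suc N))
      (cong (ℤ._* ℤ.+ suc N) (trans (ℤ.pos-+ (w * q) (suc p * suc s))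
        (cong₂ ℤ._+_ (ℤ.pos-* w q) (ℤ.pos-* (suc p) (suc s))))))
    (ℤ.+<+ natural)
/-<-+ _ _ _ _ _ {mkℚ (ℤ.+ 0) _ _}      (ℚ.*<* (ℤ.+<+ ()))
/-<-+ _ _ _ _ _ {mkℚ ℤ.-[1+ _ ] _ _} (ℚ.*<* ())

ratio-limit : ∀ {k} .{{_ : NonZero k}} (a : ∀ N → k ≤ N → ℕ) (w s D : ℕ) .{{_ : NonZero s}} →
  (∀ N k≤N → w * N ≤ a N k≤N * s) → (∀ N k≤N → a N k≤N * s ≤ w * N + D) →
  HasLimit (λ N k≤N → ℚ._/_ (ℤ.+ a N k≤N) N {{>-nonZero (≤-trans (>-nonZero⁻¹ k) k≤N)}})
           (fromℚ (ℤ.+ w ℚ./ s))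
-- With the threshold a successor, M ≤ N is by definition the strict inequality that `/-<-+` asks
-- for.
ratio-limit {k} a w s D lower upper ε 0<ε = suc (D * ℚ.↧ₙ ε) , λ N k≤N D<N →
  let instance N≢0 = >-nonZero (≤-trans (>-nonZero⁻¹ k) k≤N)
  in ∣-fromℚ∣< 0<ε (/-mono-≤ w (a N k≤N) s N (lower N k≤N))
                   (/-<-+ w (a N k≤N) D s N 0<ε (upper N k≤N) D<N)

-- Existence of the limit.

cov-lower : (H : Graph (suc h)) (t w s : ℕ) → (∀ S → w * ∣ S ∣ ≤ weight H t S * s) →
  ∀ N (h≤N : suc h ≤ N) → w * N ≤ cov t N H h≤N * s
cov-lower H t w s w≤ N h≤N =
  let G , G-covered , #K≡cov = IsCov.attained (cov-isCov t N H h≤N)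
  in ≤-trans (#K-lower H G t w s w≤ G-covered) (≤-reflexive (cong (_* s) #K≡cov))

corollary1p5 : ∀ {h : ℕ} .{{_ : NonZero h}} (H : Graph h) (t : ℕ) .{{_ : NonZero t}} →
    ∃ λ (L : ℝ) → HasLimit (covRatio t H) L
corollary1p5 {zero}  {{h≢0}} H t = contradiction refl (≢-nonZero⁻¹ 0 {{h≢0}})
corollary1p5 {suc h} H t =
  let S , 0<s , best = cheapest H t
      instance s≢0 = >-nonZero 0<s
      D , upper = cov-upper H t S
      w = weight H t S
  -- The limit is w(S) / |S| for the optimal S; its optimality `best` is the hypothesis `w≤` of the
  -- lower bound.
  in fromℚ (ℤ.+ w ℚ./ ∣ S ∣) ,
     ratio-limit (λ N h≤N → cov t N H h≤N) w ∣ S ∣ D (cov-lower H t w ∣ S ∣ best) upper
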